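{- For every finite simple undirected graph $G$, $\dim(\mathrm{TECSP}(G)) = |\mathrm{CP}(G)|$.
   Context: All graphs are finite, simple and undirected. For $\emptyset\subsetneq S\subsetneq V(G)$, $\delta(S)$ denotes the set of edges of $G$ with exactly one endpoint in $S$; such a set is called a cut, and a cut with $k$ edges is a $k$-cut. An edge $e$ is a bridge if $\{e\}=\delta(S)$ for some $S$. A graph is $2$-edge-connected if it is connected and has no bridges (equivalently, any two distinct vertices are joined by two edge-disjoint paths); the empty graph and a single vertex are $2$-edge-connected. For a subgraph $H\subseteq G$, $\chi^H\in\{0,1\}^{E(G)}$ is the incidence vector of $E(H)$. The $2$-edge-connected subgraph polytope is $\mathrm{TECSP}(G)=\mathrm{conv}\{\chi^H : H\subseteq G \text{ is } 2\text{ -edge-connected}\}\subseteq\mathbb{R}^{E(G)}$. Two distinct edges $e,f$ are coparallel if $\{e,f\}$ is an inclusion-wise minimal cut of $G$. A coparallel class is an inclusion-wise maximal set $C$ of non-bridge edges such that every two distinct elements of $C$ are coparallel; in particular a non-bridge edge contained in no $2$-cut forms a singleton coparallel class, and bridges lie in no coparallel class. $\mathrm{CP}(G)$ is the set of coparallel classes of $G$.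
   Formalization: Minimal cuts are taken among nonempty cuts and coparallel classes are required nonempty; read literally the claim fails (triangle plus isolated vertex: dimension 1, three classes). It is proved over any ordered field, including the reals. -}

module Defs where

open import Algebra.Bundles using (CommutativeRing)
open import Data.Bool.Base using (_xor_; if_then_else_)
import Data.Bool.Properties as Bool
open import Data.Fin.Base using (Fin; _<_)
open import Data.Fin.Properties using (all?; _≟_)
open import Data.Fin.Subset
  using (Subset; inside; outside; _∈_; _⊆_; _⊂_; _∩_; _∪_; ⁅_⁆; ⊤; Nonempty)
open import Data.Fin.Subset.Properties
  using (_∈?_; _⊆?_; _⊂?_; nonempty?; anySubset?; ∈⊤)
open import Data.List.Base using (List; []; _∷_; _++_; map; filter)
open import Data.List.Membership.Propositional using () renaming (_∈_ to _∈ₗ_)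
open import Data.List.Membership.Propositional.Properties
  using (∈-++⁺ˡ; ∈-++⁺ʳ; ∈-map⁺; ∈-map⁻; ∈-filter⁺; ∈-filter⁻)
open import Data.List.Relation.Unary.Any using (here)
open import Data.List.Relation.Unary.Unique.Propositional using (Unique; []; _∷_)
import Data.List.Relation.Unary.All as All
import Data.List.Relation.Unary.Unique.Propositional.Properties as Unique
open import Data.Nat.Base using (ℕ; zero; suc) renaming (_≤_ to _≤ℕ_)
open import Data.Product.Base using (Σ; ∃-syntax; _×_; _,_; proj₂)
open import Data.Sum.Base using (_⊎_)
open import Data.Vec.Base using (_∷_; []; lookup; tabulate)
open import Data.Vec.Functional using (Vector)
import Data.Vec.Properties as Vec
open import Function.Bundles using (_⇔_; mk⇔)
open import Level using (Level; _⊔_) renaming (suc to lsuc)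
open import Relation.Binary.Construct.Closure.ReflexiveTransitive using (Star)
open import Relation.Binary.Core using (Rel)
open import Relation.Binary.PropositionalEquality.Core using (_≡_; _≢_; refl)
open import Relation.Binary.Structures using (IsTotalOrder)
open import Relation.Nullary.Decidable
  using (Dec; yes; no; ¬?; _×-dec_; _→-dec_; decidable-stable)
open import Relation.Nullary.Negation using (¬_; contradiction)
open import Relation.Unary using (Pred; Decidable)

------------------------------------------------------------------------
-- Graphs

-- The vertices are Fin ∣V∣ and the edges are Fin ∣E∣.  An edge is a
-- two-element set of vertices {src e , tgt e}, listed with its smaller
-- element first: this excludes loops, and makes `simple` say that
-- there are no parallel edges.  The order of the endpoints has no
-- other role.
record Graph : Set where
  field
    ∣V∣     : ℕ
    ∣E∣     : ℕ
    src     : Fin ∣E∣ → Fin ∣V∣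
    tgt     : Fin ∣E∣ → Fin ∣V∣
    src<tgt : ∀ e → src e < tgt e
    simple  : ∀ e f → src e ≡ src f → tgt e ≡ tgt f → e ≡ f

  Joins : Fin ∣E∣ → Fin ∣V∣ → Fin ∣V∣ → Set
  Joins e u v = (src e ≡ u × tgt e ≡ v) ⊎ (src e ≡ v × tgt e ≡ u)

record Subgraph (G : Graph) : Set where
  open Graph G
  field
    V      : Subset ∣V∣
    E      : Subset ∣E∣
    closed : ∀ e → e ∈ E → src e ∈ V × tgt e ∈ V

module _ {G : Graph} (H : Subgraph G) where
  open Graph G
  open Subgraph H

  Adjacent : Rel (Fin ∣V∣) _
  Adjacent u v = ∃[ e ] (e ∈ E × Joins e u v)

  Connected : Set
  Connected = ∀ u v → u ∈ V → v ∈ V → Star Adjacent u v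

  δ : Subset ∣V∣ → Subset ∣E∣
  δ S = E ∩ tabulate (λ e → lookup S (src e) xor lookup S (tgt e))

  -- If H is disconnected then the empty set of edges is a cut.
  IsCut : Pred (Subset ∣E∣) _
  IsCut C = ∃[ S ] (Nonempty S × S ⊂ V × C ≡ δ S)

  IsBridge : Pred (Fin ∣E∣) _
  IsBridge e = IsCut ⁅ e ⁆

  TwoEdgeConnected : Set
  TwoEdgeConnected = Connected × (∀ e → ¬ IsBridge e)

whole : (G : Graph) → Subgraph G
whole G = record { V = ⊤ ; E = ⊤ ; closed = λ _ _ → ∈⊤ , ∈⊤ }

------------------------------------------------------------------------
-- Coparallel classes

module _ (G : Graph) where
  open Graph G

  -- Minimality is among nonempty cuts: otherwise the empty cut of a
  -- disconnected graph would be its only minimal cut.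
  IsMinimalCut : Pred (Subset ∣E∣) _
  IsMinimalCut C = IsCut (whole G) C × Nonempty C ×
    (∀ D → IsCut (whole G) D → Nonempty D → D ⊆ C → D ≡ C)

  Coparallel : Rel (Fin ∣E∣) _
  Coparallel e f = e ≢ f × IsMinimalCut (⁅ e ⁆ ∪ ⁅ f ⁆)

  PairwiseCoparallel : Pred (Subset ∣E∣) _
  PairwiseCoparallel C =
    (∀ e → e ∈ C → ¬ IsBridge (whole G) e) ×
    (∀ e f → e ∈ C → f ∈ C → e ≢ f → Coparallel e f)

  -- If every edge is a bridge then ∅ is a maximal pairwise coparallel
  -- set; it is not a class.
  IsCoparallelClass : Pred (Subset ∣E∣) _
  IsCoparallelClass C = Nonempty C × PairwiseCoparallel C ×
    (∀ D → PairwiseCoparallel D → C ⊆ D → D ≡ C)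

allSubset? : ∀ {n ℓ} {P : Pred (Subset n) ℓ} → Decidable P → Dec (∀ S → P S)
allSubset? P? with anySubset? (λ S → ¬? (P? S))
... | yes (S , ¬PS) = no λ ∀P → ¬PS (∀P S)
... | no  ∄¬P       = yes λ S → decidable-stable (P? S) λ ¬PS → ∄¬P (S , ¬PS)

infix 4 _≟ˢ_
_≟ˢ_ : ∀ {n} (S T : Subset n) → Dec (S ≡ T)
_≟ˢ_ = Vec.≡-dec Bool._≟_

isCut? : ∀ {G} (H : Subgraph G) → Decidable (IsCut H)
isCut? H C = anySubset? λ S →
  nonempty? S ×-dec S ⊂? Subgraph.V H ×-dec C ≟ˢ δ H S

module _ (G : Graph) where

  isMinimalCut? : Decidable (IsMinimalCut G)
  isMinimalCut? C = isCut? (whole G) C ×-dec nonempty? C ×-dec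
    allSubset? λ D →
      isCut? (whole G) D →-dec nonempty? D →-dec D ⊆? C →-dec D ≟ˢ C

  coparallel? : ∀ e f → Dec (Coparallel G e f)
  coparallel? e f = ¬? (e ≟ f) ×-dec isMinimalCut? (⁅ e ⁆ ∪ ⁅ f ⁆)

  pairwiseCoparallel? : Decidable (PairwiseCoparallel G)
  pairwiseCoparallel? C =
    all? (λ e → e ∈? C →-dec ¬? (isCut? (whole G) ⁅ e ⁆)) ×-dec
    all? (λ e → all? λ f →
      e ∈? C →-dec f ∈? C →-dec ¬? (e ≟ f) →-dec coparallel? e f)

  isCoparallelClass? : Decidable (IsCoparallelClass G)
  isCoparallelClass? C = nonempty? C ×-dec pairwiseCoparallel? C ×-dec
    allSubset? λ D → pairwiseCoparallel? D →-dec C ⊆? D →-dec D ≟ˢ C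

subsets : ∀ n → List (Subset n)
subsets zero    = [] ∷ []
subsets (suc n) = map (inside ∷_) (subsets n) ++ map (outside ∷_) (subsets n)

∈-subsets : ∀ {n} (S : Subset n) → S ∈ₗ subsets n
∈-subsets []            = here refl
∈-subsets (inside  ∷ S) = ∈-++⁺ˡ (∈-map⁺ (inside ∷_) (∈-subsets S))
∈-subsets (outside ∷ S) =
  ∈-++⁺ʳ (map (inside ∷_) (subsets _)) (∈-map⁺ (outside ∷_) (∈-subsets S))

subsets-unique : ∀ n → Unique (subsets n)
subsets-unique zero    = All.[] ∷ []
subsets-unique (suc n) = Unique.++⁺
  (Unique.map⁺ Vec.∷-injectiveʳ (subsets-unique n))
  (Unique.map⁺ Vec.∷-injectiveʳ (subsets-unique n))
  λ (p , q) → disjoint (∈-map⁻ (inside ∷_) p) (∈-map⁻ (outside ∷_) q)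
  where
  disjoint : ∀ {S : Subset (suc n)} →
    (∃[ T ] (T ∈ₗ subsets n × S ≡ inside ∷ T)) →
    ¬ (∃[ T ] (T ∈ₗ subsets n × S ≡ outside ∷ T))
  disjoint (_ , _ , refl) (_ , _ , ())

CP : (G : Graph) → List (Subset (Graph.∣E∣ G))
CP G = filter (isCoparallelClass? G) (subsets (Graph.∣E∣ G))

∈-CP : ∀ G C → C ∈ₗ CP G ⇔ IsCoparallelClass G C
∈-CP G C = mk⇔
  (λ C∈CP → proj₂ (∈-filter⁻ (isCoparallelClass? G) {C} {subsets ∣E∣} C∈CP))
  (∈-filter⁺ (isCoparallelClass? G) {C} {subsets ∣E∣} (∈-subsets C))
  where open Graph G

CP-unique : ∀ G → Unique (CP G)
CP-unique G = Unique.filter⁺ (isCoparallelClass? G) (subsets-unique (Graph.∣E∣ G))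

------------------------------------------------------------------------
-- Polytopes

-- The standard library has no real numbers, so polytopes are taken
-- over an arbitrary (totally) ordered field, of which ℝ is an instance.
record OrderedField c ℓ₁ ℓ₂ : Set (lsuc (c ⊔ ℓ₁ ⊔ ℓ₂)) where
  infix 4 _≤_
  field
    commutativeRing : CommutativeRing c ℓ₁
  open CommutativeRing commutativeRing public
  field
    1≉0          : 1# ≉ 0#
    inverse      : ∀ x → x ≉ 0# → ∃[ y ] (x * y ≈ 1#)
    _≤_          : Rel Carrier ℓ₂
    isTotalOrder : IsTotalOrder _≈_ _≤_
    +-monoʳ-≤    : ∀ x {y z} → y ≤ z → x + y ≤ x + z
    *-nonneg     : ∀ {x y} → 0# ≤ x → 0# ≤ y → 0# ≤ x * y

module _ {c ℓ₁ ℓ₂} (K : OrderedField c ℓ₁ ℓ₂) where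
  open OrderedField K
  open import Algebra.Properties.CommutativeMonoid.Sum +-commutativeMonoid
    using (sum)

  infix 4 _≋_
  _≋_ : ∀ {m} → Rel (Vector Carrier m) ℓ₁
  x ≋ y = ∀ i → x i ≈ y i

  combination : ∀ {m k} → Vector Carrier k → Vector (Vector Carrier m) k →
                Vector Carrier m
  combination a p i = sum λ j → a j * p j i

  Conv : ∀ {m ℓ} → Pred (Vector Carrier m) ℓ →
         Pred (Vector Carrier m) (c ⊔ ℓ₁ ⊔ ℓ₂ ⊔ ℓ)
  Conv {m} X x = Σ ℕ λ k →
    Σ (Vector Carrier k) λ a → Σ (Vector (Vector Carrier m) k) λ p →
      (∀ j → X (p j)) × (∀ j → 0# ≤ a j) × sum a ≈ 1# × x ≋ combination a p

  AffinelyIndependent : ∀ {m k} → Vector (Vector Carrier m) k → Set (c ⊔ ℓ₁)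
  AffinelyIndependent {k = k} p = (a : Vector Carrier k) →
    sum a ≈ 0# → (∀ i → combination a p i ≈ 0#) → ∀ j → a j ≈ 0#

  -- The largest number of affinely independent points of X is d + 1.
  HasDimension : ∀ {m ℓ} → Pred (Vector Carrier m) ℓ → ℕ → Set (c ⊔ ℓ₁ ⊔ ℓ)
  HasDimension {m} X d =
    (Σ (Vector (Vector Carrier m) (suc d)) λ p →
      (∀ j → X (p j)) × AffinelyIndependent p) ×
    (∀ k (p : Vector (Vector Carrier m) k) →
      (∀ j → X (p j)) → AffinelyIndependent p → k ≤ℕ suc d)

  χ : ∀ {G} → Subgraph G → Vector Carrier (Graph.∣E∣ G)
  χ H e = if lookup (Subgraph.E H) e then 1# else 0#

  TECSP : (G : Graph) → Pred (Vector Carrier (Graph.∣E∣ G)) (c ⊔ ℓ₁ ⊔ ℓ₂)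
  TECSP G = Conv λ x → Σ (Subgraph G) λ H → TwoEdgeConnected H × x ≋ χ H

{-# OPTIONS --safe #-}
module Submission where

-- A two-edge-connected subgraph contains no bridge of G and meets each coparallel class in
-- all or none of its edges, so a point of TECSP(G) is determined by its coordinates at one
-- representative per class: the dimension is at most ∣CP(G)∣.
--
-- Conversely, let N be the set of non-bridges.  Deleting a whole class C from N creates no
-- bridges, since modulo 2-cuts such a bridge would be a bridge of G or coparallel to C.
-- The components of a bridgeless spanning subgraph (V , F) are two-edge-connected, so by
-- averaging their incidence vectors a positive multiple of χ^F lies in TECSP(G).  The
-- ∣CP(G)∣ + 1 points obtained from N and from all N ∖ C, with a common factor 1/(∣V∣ + 1),
-- are affinely independent: up to sign and that factor, their differences are the χ^C.

open import Defs

import Algebra.Properties.CommutativeSemigroup as CommutativeSemigroupProperties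
open import Data.Bool.Base using (Bool; true; false; not; _∧_; _∨_; _xor_; if_then_else_)
open import Data.Bool.Properties as Bool using (xor-same; xor-comm; xor-∧-commutativeRing)
import Data.Empty as Empty
open import Data.Fin.Base using (Fin; zero; suc; punchIn; punchOut)
open import Data.Fin.Properties
  using (_≟_; all?; punchIn-punchOut; punchInᵢ≢i)
open import Data.Fin.Subset
  using (Subset; _∈_; _⊆_; _∩_; _∪_; ∁; ⁅_⁆; ⊥; Nonempty)
open import Data.Fin.Subset.Properties
  using (_∈?_; x∈⁅x⁆; x∈⁅y⁆⇒x≡y; x∈p∪q⁻; ⊆-antisym; anySubset?; ∈⊤; x∈p∩q⁻)
open import Data.List.Base as List using (List; []; _∷_; length; allFin)
open import Data.List.Membership.Propositional using () renaming (_∈_ to _∈ₗ_)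
open import Data.List.Membership.Propositional.Properties using (∈-lookup; ∈-allFin)
import Data.List.Relation.Unary.All as All
open import Data.List.Relation.Unary.Any as Any using (here; there)
open import Data.List.Relation.Unary.Any.Properties using (lookup-index)
open import Data.List.Relation.Unary.AllPairs using (_∷_)
open import Data.List.Relation.Unary.Unique.Propositional using (Unique)
open import Data.Nat.Base as ℕ using (ℕ; zero; suc)
import Data.Nat.Properties as ℕ
open import Data.Product.Base using (∃-syntax; _×_; _,_; proj₁; proj₂)
open import Data.Sum.Base using (_⊎_; inj₁; inj₂; swap)
open import Data.Vec.Base using (lookup; tabulate; zipWith)
open import Data.Vec.Functional using (Vector; removeAt) renaming (_∷_ to _◂_)
open import Data.Vec.Properties
  using (lookup-zipWith; lookup∘tabulate; lookup-replicate; lookup-map;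
         tabulate∘lookup; tabulate-cong; []=⇒lookup; lookup⇒[]=)
open import Function.Base using (_∘_)
open import Function.Bundles using (module Equivalence)
open import Relation.Binary.Construct.Closure.ReflexiveTransitive using (Star; ε; _◅_; _◅◅_)
open import Relation.Binary.PropositionalEquality
  using (_≡_; _≢_; refl; sym; trans; cong; cong₂; subst)
open import Relation.Nullary.Decidable using (Dec; yes; no; does; dec-true; dec-false)
open import Relation.Nullary.Negation using (¬_; contradiction)

private variable
  n : ℕ

-- Subsets as vectors over 𝔽₂.

lookup-ext : {S T : Subset n} → (∀ i → lookup S i ≡ lookup T i) → S ≡ T
lookup-ext {S = S} {T} eq =
  trans (sym (tabulate∘lookup S)) (trans (tabulate-cong eq) (tabulate∘lookup T))

∉⇒lookup : {S : Subset n} {i : Fin n} → ¬ i ∈ S → lookup S i ≡ false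
∉⇒lookup {S = S} {i} i∉S with lookup S i in eq
... | true  = contradiction (lookup⇒[]= i S eq) i∉S
... | false = refl

lookup-false⇒∉ : {S : Subset n} {i : Fin n} → lookup S i ≡ false → ¬ i ∈ S
lookup-false⇒∉ eq i∈S with () ← trans (sym eq) ([]=⇒lookup i∈S)

-- Opaque so that i and j can be inferred from ind i j.
opaque
  ind : Fin n → Fin n → Bool
  ind i j = does (i ≟ j)

  ind-same : (i : Fin n) → ind i i ≡ true
  ind-same i = dec-true (i ≟ i) refl

  ind-≢ : {i j : Fin n} → i ≢ j → ind i j ≡ false
  ind-≢ {i = i} {j} = dec-false (i ≟ j)

xor-ind-≢ : ∀ b {i j : Fin n} → i ≢ j → b xor ind i j ≡ b
xor-ind-≢ b i≢j = trans (cong (b xor_) (ind-≢ i≢j)) (Bool.xor-identityʳ b)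

lookup-⁅⁆ : (i j : Fin n) → lookup ⁅ i ⁆ j ≡ ind i j
lookup-⁅⁆ i j with i ≟ j
... | yes refl = trans ([]=⇒lookup (x∈⁅x⁆ i)) (sym (ind-same i))
... | no i≢j   = trans (∉⇒lookup (i≢j ∘ sym ∘ x∈⁅y⁆⇒x≡y i)) (sym (ind-≢ i≢j))

-- Distinct singletons are disjoint, so `∨` agrees with `xor` and a pair becomes a sum of two unit
-- vectors over 𝔽₂.
lookup-⁅⁆∪⁅⁆ : {i j : Fin n} → i ≢ j → ∀ k →
  lookup (⁅ i ⁆ ∪ ⁅ j ⁆) k ≡ ind i k xor ind j k
lookup-⁅⁆∪⁅⁆ {i = i} {j} i≢j k
  rewrite lookup-zipWith _∨_ k ⁅ i ⁆ ⁅ j ⁆ | lookup-⁅⁆ i k | lookup-⁅⁆ j k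
  with i ≟ k
... | yes refl rewrite ind-same i | ind-≢ (i≢j ∘ sym) = refl
... | no i≢k   rewrite ind-≢ i≢k = refl

xor-interchange : ∀ a b c d → (a xor b) xor (c xor d) ≡ (a xor c) xor (b xor d)
xor-interchange = CommutativeSemigroupProperties.interchange +-commutativeSemigroup
  where
  open import Algebra.Bundles using (CommutativeRing; CommutativeMonoid)
  open CommutativeMonoid (CommutativeRing.+-commutativeMonoid xor-∧-commutativeRing)
    using () renaming (commutativeSemigroup to +-commutativeSemigroup)

xor-cancelᵐ : ∀ a b c → (a xor b) xor (b xor c) ≡ a xor c
xor-cancelᵐ false false c     = refl
xor-cancelᵐ false true  false = refl
xor-cancelᵐ false true  true  = refl
xor-cancelᵐ true  false c     = refl
xor-cancelᵐ true  true  false = refl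
xor-cancelᵐ true  true  true  = refl

lookup-injective : ∀ {a} {A : Set a} {xs : List A} → Unique xs →
  ∀ {i j} → List.lookup xs i ≡ List.lookup xs j → i ≡ j
lookup-injective (x∉ ∷ _) {zero}  {zero}  _  = refl
lookup-injective (x∉ ∷ _) {zero}  {suc j} eq =
  contradiction eq (All.lookup x∉ (∈-lookup j))
lookup-injective (x∉ ∷ _) {suc i} {zero}  eq =
  contradiction (sym eq) (All.lookup x∉ (∈-lookup i))
lookup-injective (_ ∷ u)  {suc i} {suc j} eq = cong suc (lookup-injective u eq)

-- Cuts and coparallel classes

module Cuts (G : Graph) where
  open Graph G

  -- Allowing empty and full `S` makes these vectors a space over 𝔽₂, with `_⊕_` inducing its
  -- addition.
  cut : Subset ∣V∣ → Fin ∣E∣ → Bool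
  cut S e = lookup S (src e) xor lookup S (tgt e)

  _⊕_ : Subset ∣V∣ → Subset ∣V∣ → Subset ∣V∣
  _⊕_ = zipWith _xor_

  cut-⊕ : ∀ S T e → cut (S ⊕ T) e ≡ cut S e xor cut T e
  cut-⊕ S T e
    rewrite lookup-zipWith _xor_ (src e) S T | lookup-zipWith _xor_ (tgt e) S T
    = xor-interchange (lookup S (src e)) _ _ _

  lookup-δ : ∀ (H : Subgraph G) S e →
    lookup (δ H S) e ≡ lookup (Subgraph.E H) e ∧ cut S e
  lookup-δ H S e = trans (lookup-zipWith _∧_ e (Subgraph.E H) _)
    (cong (lookup (Subgraph.E H) e ∧_) (lookup∘tabulate _ e))

  -- Replacing `S` by `S ∩ V` changes no value on `E`, as both ends of such an edge lie in `V`. An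
  -- edge of `C` has exactly one end in the new set, which is therefore nonempty and proper.
  isCut⁺ : ∀ (H : Subgraph G) {C} S → let open Subgraph H in
    Nonempty C → C ⊆ E → (∀ {g} → g ∈ E → cut S g ≡ lookup C g) → IsCut H C
  isCut⁺ H {C} S (c , c∈C) C⊆E eq = T , nonempty , (T⊆V , proper) , lookup-ext C≗δT
    where
    open Subgraph H
    T : Subset ∣V∣
    T = S ∩ V

    T⊆V : T ⊆ V
    T⊆V u∈T = proj₂ (x∈p∩q⁻ S V u∈T)

    lookup-T : ∀ {u} → u ∈ V → lookup T u ≡ lookup S u
    lookup-T {u} u∈V rewrite lookup-zipWith _∧_ u S V | []=⇒lookup u∈V
      = Bool.∧-identityʳ _

    cut-T : ∀ {g} → g ∈ E → cut T g ≡ lookup C g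
    cut-T {g} g∈E = trans
      (cong₂ _xor_ (lookup-T (proj₁ (closed g g∈E))) (lookup-T (proj₂ (closed g g∈E))))
      (eq g∈E)

    ends : (src c ∈ T × ¬ tgt c ∈ T) ⊎ (tgt c ∈ T × ¬ src c ∈ T)
    ends with lookup T (src c) in p | lookup T (tgt c) in q
            | trans (cut-T (C⊆E c∈C)) ([]=⇒lookup c∈C)
    ... | true  | false | _ = inj₁ (lookup⇒[]= _ T p , lookup-false⇒∉ q)
    ... | false | true  | _ = inj₂ (lookup⇒[]= _ T q , lookup-false⇒∉ p)
    ... | true  | true  | ()
    ... | false | false | ()

    nonempty : Nonempty T
    nonempty with ends
    ... | inj₁ (p , _) = _ , p
    ... | inj₂ (p , _) = _ , p

    proper : ∃[ u ] (u ∈ V × ¬ u ∈ T)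
    proper with ends
    ... | inj₁ (_ , p) = _ , proj₂ (closed c (C⊆E c∈C)) , p
    ... | inj₂ (_ , p) = _ , proj₁ (closed c (C⊆E c∈C)) , p

    C≗δT : ∀ g → lookup C g ≡ lookup (δ H T) g
    C≗δT g with lookup E g in g∈?E | lookup-δ H T g
    ... | true  | p = sym (trans p (cut-T (lookup⇒[]= g E g∈?E)))
    ... | false | p = trans (∉⇒lookup (lookup-false⇒∉ g∈?E ∘ C⊆E)) (sym p)

  isCut⁻ : ∀ (H : Subgraph G) {C} → IsCut H C → let open Subgraph H in
    ∃[ S ] (S ⊆ V × C ⊆ E × (∀ {g} → g ∈ E → cut S g ≡ lookup C g))
  isCut⁻ H {C} (S , _ , (S⊆V , _) , refl) = S , S⊆V , proj₁ ∘ x∈p∩q⁻ E _ , eq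
    where
    open Subgraph H
    eq : ∀ {g} → g ∈ E → cut S g ≡ lookup (δ H S) g
    eq {g} g∈E rewrite lookup-δ H S g | []=⇒lookup g∈E = refl

  isBridge⁺ : ∀ (H : Subgraph G) {e} S → let open Subgraph H in
    e ∈ E → (∀ {g} → g ∈ E → cut S g ≡ ind e g) → IsBridge H e
  isBridge⁺ H {e} S e∈E eq = isCut⁺ H S (e , x∈⁅x⁆ e)
    (λ f∈ → subst (_∈ Subgraph.E H) (sym (x∈⁅y⁆⇒x≡y e f∈)) e∈E)
    (λ {g} g∈E → trans (eq g∈E) (sym (lookup-⁅⁆ e g)))

  Bridge : Fin ∣E∣ → Set
  Bridge e = ∃[ S ] (∀ g → cut S g ≡ ind e g)

  -- Coparallelism without minimality and with `e ~ e` allowed (the zero vector is the cut of `⊥`),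
  -- which makes it an equivalence relation. Any two bridges are related as well.
  infix 4 _~_
  _~_ : Fin ∣E∣ → Fin ∣E∣ → Set
  e ~ f = ∃[ S ] (∀ g → cut S g ≡ ind e g xor ind f g)

  isBridge⇒bridge : ∀ {e} → IsBridge (whole G) e → Bridge e
  isBridge⇒bridge {e} b with S , _ , _ , eq ← isCut⁻ (whole G) b =
    S , λ g → trans (eq ∈⊤) (lookup-⁅⁆ e g)

  bridge⇒isBridge : ∀ {e} → Bridge e → IsBridge (whole G) e
  bridge⇒isBridge (S , eq) = isBridge⁺ (whole G) S ∈⊤ λ {g} _ → eq g

  ~-refl : ∀ {e} → e ~ e
  ~-refl {e} = ⊥ , λ g → trans
    (cong₂ _xor_ (lookup-replicate (src g) false) (lookup-replicate (tgt g) false))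
    (sym (xor-same (ind e g)))

  ~-sym : ∀ {e f} → e ~ f → f ~ e
  ~-sym {e} {f} (S , eq) = S , λ g → trans (eq g) (xor-comm (ind e g) _)

  ~-trans : ∀ {e f h} → e ~ f → f ~ h → e ~ h
  ~-trans {e} {f} {h} (S , p) (T , q) = S ⊕ T , λ g → trans (cut-⊕ S T g)
    (trans (cong₂ _xor_ (p g) (q g)) (xor-cancelᵐ (ind e g) (ind f g) (ind h g)))

  ~-bridge : ∀ {e f} → e ~ f → Bridge f → Bridge e
  ~-bridge {e} {f} (S , p) (T , q) = S ⊕ T , λ g → trans (cut-⊕ S T g)
    (trans (cong₂ _xor_ (p g) (q g))
    (trans (Bool.xor-assoc (ind e g) _ _)
    (trans (cong (ind e g xor_) (xor-same (ind f g))) (Bool.xor-identityʳ _))))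

  -- Opaque because `with` would otherwise normalise these exhaustive searches.
  opaque
    _~?_ : ∀ e f → Dec (e ~ f)
    e ~? f = anySubset? λ S → all? λ g → cut S g Bool.≟ (ind e g xor ind f g)

    bridge? : ∀ e → Dec (Bridge e)
    bridge? e = anySubset? λ S → all? λ g → cut S g Bool.≟ ind e g

  coparallel⇒~ : ∀ {e f} → Coparallel G e f → e ~ f
  coparallel⇒~ {e} {f} (e≢f , isCut , _) with S , _ , _ , eq ← isCut⁻ (whole G) isCut =
    S , λ g → trans (eq ∈⊤) (lookup-⁅⁆∪⁅⁆ e≢f g)

  -- A nonempty cut strictly inside the pair would consist of `e` or `f` alone, making that edge a
  -- bridge.
  ~⇒coparallel : ∀ {e f} → e ≢ f → ¬ Bridge e → ¬ Bridge f → e ~ f → Coparallel G e f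
  ~⇒coparallel {e} {f} e≢f ¬be ¬bf (S , eq) = e≢f , isCut , (e , e∈C) , minimal
    where
    C : Subset ∣E∣
    C = ⁅ e ⁆ ∪ ⁅ f ⁆

    lookup⇒∈C : ∀ {g} → ind e g xor ind f g ≡ true → g ∈ C
    lookup⇒∈C {g} p = lookup⇒[]= g C (trans (lookup-⁅⁆∪⁅⁆ e≢f g) p)

    e∈C : e ∈ C
    e∈C = lookup⇒∈C (cong₂ _xor_ (ind-same e) (ind-≢ (e≢f ∘ sym)))

    isCut : IsCut (whole G) C
    isCut = isCut⁺ (whole G) S (e , e∈C) (λ _ → ∈⊤)
      λ {g} _ → trans (eq g) (sym (lookup-⁅⁆∪⁅⁆ e≢f g))

    ∈C⁻ : ∀ {g} → g ∈ C → g ≡ e ⊎ g ≡ f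
    ∈C⁻ g∈C with x∈p∪q⁻ ⁅ e ⁆ ⁅ f ⁆ g∈C
    ... | inj₁ p = inj₁ (x∈⁅y⁆⇒x≡y e p)
    ... | inj₂ p = inj₂ (x∈⁅y⁆⇒x≡y f p)

    singleton : ∀ {D} h h′ → (∀ {g} → g ∈ D → g ≡ h ⊎ g ≡ h′) →
      h ∈ D → ¬ h′ ∈ D → ∀ g → lookup D g ≡ ind h g
    singleton {D} h h′ D⊆ h∈D h′∉D g with h ≟ g
    ... | yes refl = trans ([]=⇒lookup h∈D) (sym (ind-same h))
    ... | no h≢g   = trans (∉⇒lookup g∉D) (sym (ind-≢ h≢g))
      where
      g∉D : ¬ g ∈ D
      g∉D g∈D with D⊆ g∈D
      ... | inj₁ refl = h≢g refl
      ... | inj₂ refl = h′∉D g∈D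

    minimal : ∀ D → IsCut (whole G) D → Nonempty D → D ⊆ C → D ≡ C
    minimal D cutD (d , d∈D) D⊆C with T , _ , _ , eqD ← isCut⁻ (whole G) cutD
      with e ∈? D | f ∈? D
    ... | yes e∈D | yes f∈D = ⊆-antisym D⊆C C⊆D
      where
      C⊆D : C ⊆ D
      C⊆D g∈C with ∈C⁻ g∈C
      ... | inj₁ refl = e∈D
      ... | inj₂ refl = f∈D
    ... | yes e∈D | no f∉D = contradiction
      (T , λ g → trans (eqD ∈⊤) (singleton e f (∈C⁻ ∘ D⊆C) e∈D f∉D g)) ¬be
    ... | no e∉D | yes f∈D = contradiction
      (T , λ g → trans (eqD ∈⊤) (singleton f e (swap ∘ ∈C⁻ ∘ D⊆C) f∈D e∉D g)) ¬bf
    ... | no e∉D | no f∉D with ∈C⁻ (D⊆C d∈D)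
    ...   | inj₁ refl = contradiction d∈D e∉D
    ...   | inj₂ refl = contradiction d∈D f∉D

  pairwise⇒~ : ∀ {C} → PairwiseCoparallel G C → ∀ {e f} → e ∈ C → f ∈ C → e ~ f
  pairwise⇒~ (_ , cop) {e} {f} e∈C f∈C with e ≟ f
  ... | yes refl = ~-refl
  ... | no e≢f   = coparallel⇒~ (cop e f e∈C f∈C e≢f)

  cls : Fin ∣E∣ → Subset ∣E∣
  cls e = tabulate λ f → does (e ~? f)

  ∈-cls⁺ : ∀ {e f} → e ~ f → f ∈ cls e
  ∈-cls⁺ {e} {f} e~f =
    lookup⇒[]= f _ (trans (lookup∘tabulate _ f) (dec-true (e ~? f) e~f))

  ∈-cls⁻ : ∀ {e f} → f ∈ cls e → e ~ f
  ∈-cls⁻ {e} {f} f∈ with e ~? f | trans (sym (lookup∘tabulate _ f)) ([]=⇒lookup f∈)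
  ... | yes e~f | _ = e~f
  ... | no _    | ()

  cls-pairwise : ∀ {e} → ¬ Bridge e → PairwiseCoparallel G (cls e)
  cls-pairwise ¬b =
    (λ f f∈ → nonBridge f∈ ∘ isBridge⇒bridge) ,
    (λ f g f∈ g∈ f≢g → ~⇒coparallel f≢g (nonBridge f∈) (nonBridge g∈)
      (~-trans (~-sym (∈-cls⁻ f∈)) (∈-cls⁻ g∈)))
    where
    nonBridge : ∀ {f} → f ∈ cls _ → ¬ Bridge f
    nonBridge f∈ = ¬b ∘ ~-bridge (∈-cls⁻ f∈)

  cls-isClass : ∀ {e} → ¬ Bridge e → IsCoparallelClass G (cls e)
  cls-isClass {e} ¬b = (e , e∈) , cls-pairwise ¬b ,
    λ D pD cls⊆D → ⊆-antisym (λ f∈D → ∈-cls⁺ (pairwise⇒~ pD (cls⊆D e∈) f∈D)) cls⊆D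
    where
    e∈ : e ∈ cls e
    e∈ = ∈-cls⁺ ~-refl

  class-nonBridge : ∀ {C} → IsCoparallelClass G C → ∀ {e} → e ∈ C → ¬ Bridge e
  class-nonBridge (_ , (nb , _) , _) {e} e∈C = nb e e∈C ∘ bridge⇒isBridge

  -- `C` lies in `cls e`, which is itself pairwise coparallel, so maximality of `C` gives equality.
  -- Hence classes sharing an edge coincide.
  class≡cls : ∀ {C} → IsCoparallelClass G C → ∀ {e} → e ∈ C → C ≡ cls e
  class≡cls (_ , pC , max) e∈C = sym (max _
    (cls-pairwise (proj₁ pC _ e∈C ∘ bridge⇒isBridge))
    (λ f∈C → ∈-cls⁺ (pairwise⇒~ pC e∈C f∈C)))

  -- Two-edge-connected subgraphs

  bridge∉2EC : ∀ (H : Subgraph G) → TwoEdgeConnected H →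
    ∀ {e} → Bridge e → ¬ e ∈ Subgraph.E H
  bridge∉2EC H (_ , nb) {e} (S , eq) e∈E = nb e (isBridge⁺ H S e∈E λ {g} _ → eq g)

  -- If `f` were missing, the cut `{e , f}` of `G` would restrict to `{e}` on `H`.
  2EC-⊆ : ∀ (H : Subgraph G) → TwoEdgeConnected H → ∀ {e f} → e ~ f →
    e ∈ Subgraph.E H → f ∈ Subgraph.E H
  2EC-⊆ H (_ , nb) {e} {f} (S , eq) e∈E with f ∈? Subgraph.E H
  ... | yes f∈E = f∈E
  ... | no f∉E = contradiction (isBridge⁺ H S e∈E eq′) (nb e)
    where
    eq′ : ∀ {g} → g ∈ Subgraph.E H → cut S g ≡ ind e g
    eq′ {g} g∈E = trans (eq g) (xor-ind-≢ (ind e g) λ { refl → f∉E g∈E })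

  2EC-lookup : ∀ (H : Subgraph G) → TwoEdgeConnected H → ∀ {e f} → e ~ f →
    lookup (Subgraph.E H) e ≡ lookup (Subgraph.E H) f
  2EC-lookup H tec {e} {f} e~f with e ∈? Subgraph.E H
  ... | yes e∈E = trans ([]=⇒lookup e∈E) (sym ([]=⇒lookup (2EC-⊆ H tec e~f e∈E)))
  ... | no e∉E  = trans (∉⇒lookup e∉E)
    (sym (∉⇒lookup (e∉E ∘ 2EC-⊆ H tec (~-sym e~f))))

  -- Bridgeless edge sets

  -- No edge is a bridge of the spanning subgraph with edge set F.
  Bridgeless : Subset ∣E∣ → Set
  Bridgeless F = ∀ {e} S → e ∈ F → ¬ (∀ {g} → g ∈ F → cut S g ≡ ind e g)

  -- Gaussian elimination over 𝔽₂: cuts that restrict to single edges outside X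
  -- clear the corresponding coordinates of the cut of S.
  eliminate : ∀ {F : Subset ∣E∣} {X : Fin ∣E∣ → Set} →
    (∀ b → ¬ b ∈ F → ∃[ T ] (∀ {g} → ¬ X g → cut T g ≡ ind b g)) →
    ∀ es S → ∃[ S′ ] ((∀ {g} → ¬ X g → g ∈ F → cut S′ g ≡ cut S g) ×
                      (∀ {g} → ¬ X g → g ∈ₗ es → ¬ g ∈ F → cut S′ g ≡ false))
  eliminate single []       S = S , (λ _ _ → refl) , λ _ ()
  eliminate {F} {X} single (b ∷ es) S
    with S₁ , keep , clear ← eliminate {F} {X} single es S
    with b ∈? F | cut S₁ b in cutb
  ... | yes b∈F | _ = S₁ , keep , λ where
    x (here refl) b∉F → contradiction b∈F b∉F
    x (there g∈)  g∉F → clear x g∈ g∉F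
  ... | no _    | false = S₁ , keep , λ where
    x (here refl) _   → cutb
    x (there g∈)  g∉F → clear x g∈ g∉F
  -- Outside `X`, adding `T` flips the coordinate `b` and no other, so coordinates cleared earlier
  -- stay clear.
  ... | no b∉F  | true with T , single-T ← single b b∉F = S₁ ⊕ T , keep′ , clear′
    where
    other : ∀ {g} → ¬ X g → b ≢ g → cut (S₁ ⊕ T) g ≡ cut S₁ g
    other {g} x b≢g = trans (cut-⊕ S₁ T g)
      (trans (cong (cut S₁ g xor_) (trans (single-T x) (ind-≢ b≢g)))
      (Bool.xor-identityʳ _))

    self : ¬ X b → cut (S₁ ⊕ T) b ≡ false
    self x = trans (cut-⊕ S₁ T b) (cong₂ _xor_ cutb (trans (single-T x) (ind-same b)))

    keep′ : ∀ {g} → ¬ X g → g ∈ F → cut (S₁ ⊕ T) g ≡ cut S g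
    keep′ x g∈F = trans (other x λ { refl → b∉F g∈F }) (keep x g∈F)

    clear′ : ∀ {g} → ¬ X g → g ∈ₗ b ∷ es → ¬ g ∈ F → cut (S₁ ⊕ T) g ≡ false
    clear′     x (here refl) _   = self x
    clear′ {g} x (there g∈)  g∉F with b ≟ g
    ... | yes refl = self x
    ... | no b≢g   = trans (other x b≢g) (clear x g∈ g∉F)

  -- A bridge of `F` lifts to `G`: once every edge outside `F` is cleared, its cut is `{e}` up to
  -- edges in `X`.
  eliminate-all : ∀ {F : Subset ∣E∣} {X : Fin ∣E∣ → Set} →
    (∀ b → ¬ b ∈ F → ∃[ T ] (∀ {g} → ¬ X g → cut T g ≡ ind b g)) →
    ∀ {e} S → e ∈ F → (∀ {g} → g ∈ F → cut S g ≡ ind e g) →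
    ∃[ S′ ] (∀ {g} → ¬ X g → cut S′ g ≡ ind e g)
  eliminate-all {F} {X} single {e} S e∈F eq
    with S′ , keep , clear ← eliminate {F} {X} single (allFin ∣E∣) S = S′ , eq′
    where
    eq′ : ∀ {g} → ¬ X g → cut S′ g ≡ ind e g
    eq′ {g} x with g ∈? F
    ... | yes g∈F = trans (keep x g∈F) (eq g∈F)
    ... | no g∉F  = trans (clear x (∈-allFin g) g∉F)
      (sym (ind-≢ {i = e} λ { refl → g∉F e∈F }))

  -- The non-bridges, with and without one class.

  nonBridges : Subset ∣E∣
  nonBridges = tabulate λ e → not (does (bridge? e))

  ∈-nonBridges⁺ : ∀ {e} → ¬ Bridge e → e ∈ nonBridges
  ∈-nonBridges⁺ {e} ¬b =
    lookup⇒[]= e _ (trans (lookup∘tabulate _ e) (cong not (dec-false (bridge? e) ¬b)))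

  ∈-nonBridges⁻ : ∀ {e} → e ∈ nonBridges → ¬ Bridge e
  ∈-nonBridges⁻ {e} e∈ b
    with () ← trans (sym ([]=⇒lookup e∈))
                (trans (lookup∘tabulate _ e) (cong not (dec-true (bridge? e) b)))

  ∉-nonBridges : ∀ {e} → ¬ e ∈ nonBridges → Bridge e
  ∉-nonBridges {e} e∉ with bridge? e
  ... | yes b = b
  ... | no ¬b = contradiction (∈-nonBridges⁺ ¬b) e∉

  -- Each deleted edge is by itself a cut of `G`, so elimination with `X` empty would turn a bridge
  -- of the remainder into a bridge of `G`.
  nonBridges-bridgeless : Bridgeless nonBridges
  nonBridges-bridgeless S e∈N eq
    with S′ , eq′ ← eliminate-all {X = λ _ → Empty.⊥}
           (λ b b∉N → let T , p = ∉-nonBridges b∉N in T , λ {g} _ → p g) S e∈N eq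
    = ∈-nonBridges⁻ e∈N (S′ , λ g → eq′ λ ())

  lookup-without : ∀ C e → lookup (nonBridges ∩ ∁ C) e ≡ lookup nonBridges e ∧ not (lookup C e)
  lookup-without C e = trans (lookup-zipWith _∧_ e nonBridges (∁ C))
    (cong (lookup nonBridges e ∧_) (lookup-map e not C))

  -- A cut of G consisting of one edge e of nonBridges ∩ ∁ C, some bridges and some
  -- edges of C reduces, modulo cuts {b} and {c, c₀}, to {e} or {e, c₀}.
  without-bridgeless : ∀ {C} → IsCoparallelClass G C → Bridgeless (nonBridges ∩ ∁ C)
  without-bridgeless {C} isClass@((c₀ , c₀∈C) , pC , _) {e} S e∈F eq =
    absurd (eliminate-all {X = _≡ c₀} single S e∈F eq)
    where
    F : Subset ∣E∣
    F = nonBridges ∩ ∁ C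

    single : ∀ b → ¬ b ∈ F → ∃[ T ] (∀ {g} → g ≢ c₀ → cut T g ≡ ind b g)
    single b b∉F with bridge? b | b ∈? C
    ... | yes (T , p) | _ = T , λ {g} _ → p g
    -- Away from `c₀` the cut `{b , c₀}` looks like `{b}`; this is why `X` consists of `c₀`. For
    -- `b ≡ c₀` both vanish there.
    ... | no _  | yes b∈C with T , p ← pairwise⇒~ pC b∈C c₀∈C =
      T , λ {g} g≢c₀ → trans (p g) (xor-ind-≢ (ind b g) (g≢c₀ ∘ sym))
    ... | no ¬b | no b∉C = contradiction
      (lookup⇒[]= b F (trans (lookup-without C b)
        (cong₂ (λ x y → x ∧ not y) ([]=⇒lookup (∈-nonBridges⁺ ¬b)) (∉⇒lookup b∉C)))) b∉F

    e∉C : ¬ e ∈ C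
    e∉C e∈C with () ← trans (sym ([]=⇒lookup e∈F)) (trans (lookup-without C e)
      (trans (cong (λ x → lookup nonBridges e ∧ not x) ([]=⇒lookup e∈C)) (Bool.∧-zeroʳ _)))

    e≢c₀ : e ≢ c₀
    e≢c₀ refl = e∉C c₀∈C

    absurd : ¬ (∃[ T ] (∀ {g} → g ≢ c₀ → cut T g ≡ ind e g))
    absurd (T , eqT) with cut T c₀ in cutc₀
    ... | false = ∈-nonBridges⁻ (proj₁ (x∈p∩q⁻ nonBridges _ e∈F)) (T , bridge)
      where
      bridge : ∀ g → cut T g ≡ ind e g
      bridge g with g ≟ c₀
      ... | yes refl = trans cutc₀ (sym (ind-≢ e≢c₀))
      ... | no g≢c₀  = eqT g≢c₀
    -- Now the cut is `{e , c₀}`, which would put `e` into the class of `c₀`.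
    ... | true = e∉C (subst (e ∈_) (sym (class≡cls isClass c₀∈C)) (∈-cls⁺ (~-sym (T , pair))))
      where
      pair : ∀ g → cut T g ≡ ind e g xor ind c₀ g
      pair g with g ≟ c₀
      ... | yes refl = trans cutc₀ (sym (cong₂ _xor_ (ind-≢ e≢c₀) (ind-same c₀)))
      ... | no g≢c₀  = trans (eqT g≢c₀) (sym (xor-ind-≢ (ind e g) (g≢c₀ ∘ sym)))

  -- Components of a spanning subgraph

  AdjacentBy : Subset ∣E∣ → Fin ∣V∣ → Fin ∣V∣ → Set
  AdjacentBy F u v = ∃[ e ] (e ∈ F × Joins e u v)

  -- `es` lists the edges processed so far: only these must respect labels, whereas paths may use
  -- any edge of `F`. Once `es` lists all edges, the nonempty label classes are the components of
  -- `F`.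
  record Components (F : Subset ∣E∣) (es : List (Fin ∣E∣)) : Set where
    field
      label     : Fin ∣V∣ → Fin (suc ∣V∣)
      closed    : ∀ {e} → e ∈ₗ es → e ∈ F → label (src e) ≡ label (tgt e)
      connected : ∀ {u v} → label u ≡ label v → Star (AdjacentBy F) u v

  -- The label zero is left unused, so that the set of labels is never empty.
  components : ∀ F es → Components F es
  components F [] = record
    { label = suc ; closed = λ () ; connected = λ { refl → ε } }
  components F (e ∷ es) with C ← components F es with e ∈? F
  ... | no e∉F = record
    { label     = label
    ; closed    = λ { (here refl) e∈F → contradiction e∈F e∉F ; (there g∈) → closed g∈ }
    ; connected = connected
    }
    where open Components C
  ... | yes e∈F = record
    { label = λ u → merge (label u) ; closed = closed′ ; connected = connected′ _ _ }
    where
    open Components C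
    merge : Fin (suc ∣V∣) → Fin (suc ∣V∣)
    merge l = if does (l ≟ label (src e)) then label (tgt e) else l

    merge-src : merge (label (src e)) ≡ label (tgt e)
    merge-src = cong (λ b → if b then label (tgt e) else label (src e))
      (dec-true (label (src e) ≟ label (src e)) refl)

    merge-tgt : merge (label (tgt e)) ≡ label (tgt e)
    merge-tgt with does (label (tgt e) ≟ label (src e))
    ... | true  = refl
    ... | false = refl

    closed′ : ∀ {g} → g ∈ₗ e ∷ es → g ∈ F → merge (label (src g)) ≡ merge (label (tgt g))
    closed′ (here refl) _   = trans merge-src (sym merge-tgt)
    closed′ (there g∈)  g∈F = cong merge (closed g∈ g∈F)

    connected′ : ∀ u v → merge (label u) ≡ merge (label v) → Star (AdjacentBy F) u v
    -- If just one of the two labels was changed by `merge`, the path has to cross `e`.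
    connected′ u v eq with label u ≟ label (src e) | label v ≟ label (src e)
    ... | yes p | yes q = connected (trans p (sym q))
    ... | yes p | no _  = connected p ◅◅
      (e , e∈F , inj₁ (refl , refl)) ◅ connected eq
    ... | no _  | yes q = connected eq ◅◅
      (e , e∈F , inj₂ (refl , refl)) ◅ connected (sym q)
    ... | no _  | no _  = connected eq

  module _ (F : Subset ∣E∣) where
    open Components (components F (allFin ∣E∣))

    -- Edges are selected by their source alone, since `closed` gives the target the same label. A
    -- label of no vertex yields the empty subgraph.
    component : Fin (suc ∣V∣) → Subgraph G
    component w = record { V = V ; E = E ; closed = closedʷ }
      where
      V : Subset ∣V∣
      V = tabulate λ u → does (label u ≟ w)
      E : Subset ∣E∣
      E = F ∩ tabulate λ e → does (label (src e) ≟ w)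
      closedʷ : ∀ e → e ∈ E → src e ∈ V × tgt e ∈ V
      closedʷ e e∈E with e∈F , e∈w ← x∈p∩q⁻ F _ e∈E =
        lookup⇒[]= _ V (trans (lookup∘tabulate _ (src e)) src-w) ,
        lookup⇒[]= _ V (trans (lookup∘tabulate _ (tgt e))
          (trans (cong (λ l → does (l ≟ w)) (sym (closed (∈-allFin e) e∈F))) src-w))
        where
        src-w : does (label (src e) ≟ w) ≡ true
        src-w = trans (sym (lookup∘tabulate _ e)) ([]=⇒lookup e∈w)

    lookup-component : ∀ w e → lookup (Subgraph.E (component w)) e ≡
                               lookup F e ∧ does (label (src e) ≟ w)
    lookup-component w e = trans (lookup-zipWith _∧_ e F _)
      (cong (lookup F e ∧_) (lookup∘tabulate _ e))

    ∈-componentᵛ : ∀ {w u} → u ∈ Subgraph.V (component w) → label u ≡ w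
    ∈-componentᵛ {w} {u} u∈ with label u ≟ w | trans (sym (lookup∘tabulate _ u)) ([]=⇒lookup u∈)
    ... | yes eq | _ = eq
    ... | no _   | ()

    ∈-componentᵉ : ∀ {e w} → e ∈ F → label (src e) ≡ w → e ∈ Subgraph.E (component w)
    ∈-componentᵉ {e} {w} e∈F eq = lookup⇒[]= e _ (trans (lookup-component w e)
      (cong₂ _∧_ ([]=⇒lookup e∈F) (dec-true (label (src e) ≟ w) eq)))

    component-connected : ∀ w → Connected (component w)
    component-connected w u v u∈ v∈ = lift (∈-componentᵛ {w} u∈)
      (connected (trans (∈-componentᵛ {w} u∈) (sym (∈-componentᵛ {w} v∈))))
      where
      lift : ∀ {u v} → label u ≡ w → Star (AdjacentBy F) u v → Star (Adjacent (component w)) u v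
      lift eq ε = ε
      lift eq ((e , e∈F , j@(inj₁ (refl , refl))) ◅ p) =
        (e , ∈-componentᵉ e∈F eq , j) ◅ lift (trans (sym (closed (∈-allFin e) e∈F)) eq) p
      lift eq ((e , e∈F , j@(inj₂ (refl , refl))) ◅ p) =
        (e , ∈-componentᵉ e∈F eq′ , j) ◅ lift eq′ p
        where eq′ = trans (closed (∈-allFin e) e∈F) eq

    -- An edge of `F` outside the component has no end in `S ⊆ V`, so a cut `{e}` of the component
    -- is a cut `{e}` of all of `F`.
    component-2EC : Bridgeless F → ∀ w → TwoEdgeConnected (component w)
    component-2EC bl w = component-connected w , noBridge
      where
      open Subgraph (component w) using (V; E)
      noBridge : ∀ e → ¬ IsBridge (component w) e
      noBridge e b with S , S⊆V , e⊆E , eq ← isCut⁻ (component w) b =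
        bl S (proj₁ (x∈p∩q⁻ F _ e∈E)) cut-F
        where
        e∈E : e ∈ E
        e∈E = e⊆E (x∈⁅x⁆ e)
        cut-F : ∀ {g} → g ∈ F → cut S g ≡ ind e g
        cut-F {g} g∈F with label (src g) ≟ w
        ... | yes p = trans (eq (∈-componentᵉ g∈F p)) (lookup-⁅⁆ e g)
        ... | no p  = trans
          (cong₂ _xor_ (∉⇒lookup (p ∘ ∈-componentᵛ {w} ∘ S⊆V))
            (∉⇒lookup (p ∘ trans (closed (∈-allFin g) g∈F) ∘ ∈-componentᵛ {w} ∘ S⊆V)))
          (sym (ind-≢ λ { refl →
            p (∈-componentᵛ {w} (proj₁ (Subgraph.closed (component w) e e∈E))) }))

-- Ordered fields and linear dependence

module _ {c ℓ₁ ℓ₂} (K : OrderedField c ℓ₁ ℓ₂) where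
  open OrderedField K hiding (zero)
    renaming (refl to ≈-refl; sym to ≈-sym; trans to ≈-trans)
  open import Algebra.Properties.Semiring.Sum semiring
    using (sum; sum-cong-≋; sum-replicate; sum-replicate-zero; sum-remove; ∑-distrib-+;
           *-distribˡ-sum; *-distribʳ-sum)
  open import Algebra.Properties.Monoid.Mult +-monoid using () renaming (_×_ to _·_)
  open import Algebra.Properties.Ring ring
    using (-‿distribˡ-*; -‿distribʳ-*; -‿involutive; +-cancelʳ; -1*x≈-x)
  open import Relation.Binary.Reasoning.Setoid setoid
  open import Relation.Binary.Structures using (IsTotalOrder)
  private module ≤ = IsTotalOrder isTotalOrder

  0/1 : Bool → Carrier
  0/1 b = if b then 1# else 0#

  sum-zero : ∀ {n} {f : Vector Carrier n} → (∀ i → f i ≈ 0#) → sum f ≈ 0#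
  sum-zero {n} f≈0 = ≈-trans (sum-cong-≋ f≈0) (sum-replicate-zero n)

  sum-differ : ∀ {n} (f g : Vector Carrier n) i → (∀ j → i ≢ j → f j ≈ g j) →
    sum f ≈ sum g → f i ≈ g i
  sum-differ {suc n} f g i f≈g Σf≈Σg = +-cancelʳ (sum (removeAt f i)) _ _ (begin
    f i + sum (removeAt f i)  ≈⟨ sum-remove f ⟨
    sum f                     ≈⟨ Σf≈Σg ⟩
    sum g                     ≈⟨ sum-remove g ⟩
    g i + sum (removeAt g i)  ≈⟨ +-congˡ (sum-cong-≋ λ j → ≈-sym (f≈g _ (punchInᵢ≢i i j ∘ sym))) ⟩
    g i + sum (removeAt f i)  ∎)

  sum-single : ∀ {n} (f : Vector Carrier n) i → (∀ j → i ≢ j → f j ≈ 0#) → sum f ≈ f i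
  sum-single {suc n} f i f≈0 = begin
    sum f                     ≈⟨ sum-remove f ⟩
    f i + sum (removeAt f i)  ≈⟨ +-congˡ (sum-zero λ j → f≈0 _ (punchInᵢ≢i i j ∘ sym)) ⟩
    f i + 0#                  ≈⟨ +-identityʳ _ ⟩
    f i                       ∎

  0≤-x : ∀ {x} → x ≤ 0# → 0# ≤ - x
  0≤-x {x} x≤0 = ≤.trans (≤.reflexive (≈-sym (-‿inverseˡ x)))
    (≤.trans (+-monoʳ-≤ (- x) x≤0) (≤.reflexive (+-identityʳ _)))

  0≤1 : 0# ≤ 1#
  0≤1 with ≤.total 0# 1#
  ... | inj₁ p = p
  -- Here `1#` is the product of two copies of the nonnegative `- 1#`.
  ... | inj₂ p = ≤.trans (*-nonneg (0≤-x p) (0≤-x p))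
    (≤.reflexive (≈-trans (-1*x≈-x (- 1#)) (-‿involutive 1#)))

  0≤n·1 : ∀ n → 0# ≤ n · 1#
  1≤1+n·1 : ∀ n → 1# ≤ suc n · 1#
  0≤n·1 zero    = ≤.refl
  0≤n·1 (suc n) = ≤.trans 0≤1 (1≤1+n·1 n)
  1≤1+n·1 n = ≤.trans (≤.reflexive (≈-sym (+-identityʳ 1#))) (+-monoʳ-≤ 1# (0≤n·1 n))

  1+n·1≉0 : ∀ n → ¬ suc n · 1# ≈ 0#
  1+n·1≉0 n eq = 1≉0 (≤.antisym (≤.trans (1≤1+n·1 n) (≤.reflexive eq)) 0≤1)

  cancel : ∀ {x y z} → x * y ≈ 1# → z * x ≈ 0# → z ≈ 0#
  cancel {x} {y} {z} xy≈1 zx≈0 = begin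
    z            ≈⟨ *-identityʳ z ⟨
    z * 1#       ≈⟨ *-congˡ xy≈1 ⟨
    z * (x * y)  ≈⟨ *-assoc z x y ⟨
    z * x * y    ≈⟨ *-congʳ zx≈0 ⟩
    0# * y       ≈⟨ zeroˡ y ⟩
    0#           ∎

  -- Double negation commutes with finite conjunction, so a refutation may assume that a whole
  -- column vanishes.
  ¬¬-all : ∀ {n p} {P : Fin n → Set p} → (∀ i → ¬ ¬ P i) → ¬ ¬ (∀ i → P i)
  ¬¬-all {zero}  _    k = k λ ()
  ¬¬-all {suc n} ¬¬P k = ¬¬P zero λ p₀ → ¬¬-all (¬¬P ∘ suc) λ ps →
    k λ { zero → p₀ ; (suc i) → ps i }

  -- A pivot row i eliminates the first unknown; equality on K is not decidable, so the
  -- existence of a pivot is only known under double negation.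
  dependent : ∀ {m k} (A : Fin m → Vector Carrier k) → m ℕ.< k →
    ¬ ((a : Vector Carrier k) → (∀ i → sum (λ j → a j * A i j) ≈ 0#) → ∀ j → a j ≈ 0#)
  dependent {zero}  {suc k} A _ indep = 1≉0 (indep (λ _ → 1#) (λ ()) zero)
  -- If the first column vanishes, the first unit vector is a nontrivial solution.
  dependent {suc m} {suc k} A (ℕ.s≤s m<k) indep = ¬¬-all noPivot λ col≈0 →
    1≉0 (indep (1# ◂ λ _ → 0#) (λ i → begin
      1# * A i zero + sum (λ j → 0# * A i (suc j))
        ≈⟨ +-cong (*-identityˡ _) (sum-zero λ j → zeroˡ (A i (suc j))) ⟩
      A i zero + 0#  ≈⟨ +-identityʳ _ ⟩
      A i zero       ≈⟨ col≈0 i ⟩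
      0#             ∎) zero)
    where
    noPivot : ∀ i → ¬ ¬ A i zero ≈ 0#
    noPivot i p≉0 = dependent B m<k indepB
      where
      p = A i zero
      q : Fin m → Carrier
      q r = A (punchIn i r) zero
      -- Fraction-free elimination: `p` times each other row minus `q r` times the pivot row.
      B : Fin m → Vector Carrier k
      B r l = p * A (punchIn i r) (suc l) + - (q r * A i (suc l))

      indepB : ∀ b → (∀ r → sum (λ j → b j * B r j) ≈ 0#) → ∀ j → b j ≈ 0#
      indepB b Bb≈0 j = cancel (proj₂ (inverse p p≉0)) (indep a Aa≈0 (suc j))
        where
        term : Fin (suc m) → Vector Carrier k
        term r l = b l * A r (suc l)

        row : Fin (suc m) → Carrier
        row r = sum (term r)

        -- A solution `b` of the reduced system is scaled by `p`, so that the pivot unknown is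
        -- `- row i` without division.
        a : Vector Carrier (suc k)
        a = - row i ◂ λ l → b l * p

        expand : ∀ r → sum (λ j → a j * A r j) ≈ - (A r zero * row i) + p * row r
        expand r = +-cong
          (≈-trans (≈-sym (-‿distribˡ-* _ _)) (-‿cong (*-comm _ _)))
          (≈-trans (sum-cong-≋ {k} λ l → ≈-trans (*-congʳ (*-comm (b l) p)) (*-assoc p (b l) _))
            (≈-sym (*-distribˡ-sum p (term r))))

        swap-scalar : ∀ x y z → x * (y * z) ≈ y * (x * z)
        swap-scalar x y z = ≈-trans (≈-sym (*-assoc _ _ _))
          (≈-trans (*-congʳ (*-comm _ _)) (*-assoc _ _ _))

        Bb : ∀ r → sum (λ l → b l * B r l) ≈ - (q r * row i) + p * row (punchIn i r)
        Bb r = begin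
          sum (λ l → b l * (p * A r′ (suc l) + - (q r * A i (suc l))))
            ≈⟨ sum-cong-≋ {k} (λ l → ≈-trans (distribˡ (b l) _ _) (+-cong (swap-scalar (b l) p _)
                 (≈-trans (≈-sym (-‿distribʳ-* (b l) _))
                   (≈-trans (-‿cong (swap-scalar (b l) (q r) _)) (-‿distribˡ-* (q r) _))))) ⟩
          sum (λ l → p * term r′ l + - q r * term i l)
            ≈⟨ ∑-distrib-+ (λ l → p * term r′ l) _ ⟩
          sum (λ l → p * term r′ l) + sum (λ l → - q r * term i l)
            ≈⟨ +-cong (*-distribˡ-sum p (term r′)) (*-distribˡ-sum (- q r) (term i)) ⟨
          p * row r′ + - q r * row i
            ≈⟨ +-comm _ _ ⟩
          - q r * row i + p * row r′
            ≈⟨ +-congʳ (-‿distribˡ-* _ _) ⟨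
          - (q r * row i) + p * row r′ ∎
          where r′ = punchIn i r

        Aa≈0 : ∀ r → sum (λ j → a j * A r j) ≈ 0#
        Aa≈0 r with i ≟ r
        ... | yes refl = ≈-trans (expand i) (-‿inverseˡ _)
        ... | no i≢r   = subst (λ r → sum (λ j → a j * A r j) ≈ 0#) (punchIn-punchOut i≢r)
          (≈-trans (expand _) (≈-trans (≈-sym (Bb _)) (Bb≈0 (punchOut i≢r))))

  -- The polytope

  module Polytope (G : Graph) where
    open Graph G
    open Cuts G

    -- The equation holds at every `χ K H` and is linear, hence passes to convex combinations;
    -- likewise for `tecsp-~`.
    tecsp-bridge : ∀ {x} → TECSP K G x → ∀ {e} → Bridge e → x e ≈ 0#
    tecsp-bridge (k , a , p , inP , _ , _ , x≋) {e} b = ≈-trans (x≋ e) (sum-zero λ j →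
      ≈-trans (*-congˡ (p≈0 j)) (zeroʳ (a j)))
      where
      p≈0 : ∀ j → p j e ≈ 0#
      p≈0 j with H , tec , p≋ ← inP j = ≈-trans (p≋ e) (reflexive
        (cong 0/1 (∉⇒lookup (bridge∉2EC H tec b))))

    tecsp-~ : ∀ {x} → TECSP K G x → ∀ {e f} → e ~ f → x e ≈ x f
    tecsp-~ (k , a , p , inP , _ , _ , x≋) {e} {f} e~f =
      ≈-trans (x≋ e) (≈-trans (sum-cong-≋ λ j → *-congˡ (p≈ j)) (≈-sym (x≋ f)))
      where
      p≈ : ∀ j → p j e ≈ p j f
      p≈ j with H , tec , p≋ ← inP j = ≈-trans (p≋ e) (≈-trans (reflexive
        (cong 0/1 (2EC-lookup H tec e~f))) (≈-sym (p≋ f)))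

    -- The weight of each of the ∣V∣ + 1 (possibly empty) components.
    weight : Carrier
    weight = proj₁ (inverse (suc ∣V∣ · 1#) (1+n·1≉0 ∣V∣))

    sum-weight : (suc ∣V∣ · 1#) * weight ≈ 1#
    sum-weight = proj₂ (inverse (suc ∣V∣ · 1#) (1+n·1≉0 ∣V∣))

    -- A nonpositive inverse of the nonnegative `suc ∣V∣ · 1#` would make `- 1#` nonnegative.
    0≤weight : 0# ≤ weight
    0≤weight with ≤.total 0# weight
    ... | inj₁ p = p
    ... | inj₂ p = contradiction (≤.antisym 1≤0 0≤1) 1≉0
      where
      0≤-1 : 0# ≤ - 1#
      0≤-1 = ≤.trans (*-nonneg (0≤n·1 (suc ∣V∣)) (0≤-x p))
        (≤.reflexive (≈-trans (≈-sym (-‿distribʳ-* _ _)) (-‿cong sum-weight)))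
      1≤0 : 1# ≤ 0#
      1≤0 = ≤.trans (≤.reflexive (≈-sym (+-identityʳ 1#)))
        (≤.trans (+-monoʳ-≤ 1# 0≤-1) (≤.reflexive (-‿inverseʳ 1#)))

    -- The factor is the same for every `F`, because the number of labels is; this keeps the points
    -- comparable.
    scaled : Subset ∣E∣ → Vector Carrier ∣E∣
    scaled F e = weight * 0/1 (lookup F e)

    -- All components get equal weight; at an edge `e` only the component labelled `label (src e)`
    -- can contribute.
    scaled∈TECSP : ∀ F → Bridgeless F → TECSP K G (scaled F)
    scaled∈TECSP F bl = suc ∣V∣ , (λ _ → weight) , (λ w → χ K (component F w)) ,
      (λ w → component F w , component-2EC F bl w , λ _ → ≈-refl) ,
      (λ _ → 0≤weight) ,
      ≈-trans Σweight sum-weight ,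
      λ e → ≈-sym (≈-trans (sum-single _ (label (src e)) (other e)) (own e))
      where
      open Components (components F (allFin ∣E∣))
      term : Fin ∣E∣ → Fin (suc ∣V∣) → Carrier
      term e w = weight * χ K (component F w) e

      Σweight : sum {suc ∣V∣} (λ _ → weight) ≈ (suc ∣V∣ · 1#) * weight
      Σweight = begin
        sum {suc ∣V∣} (λ _ → weight)
          ≈⟨ sum-cong-≋ {suc ∣V∣} (λ _ → ≈-sym (*-identityˡ weight)) ⟩
        sum {suc ∣V∣} (λ _ → 1# * weight)
          ≈⟨ *-distribʳ-sum {suc ∣V∣} weight (λ _ → 1#) ⟨
        sum {suc ∣V∣} (λ _ → 1#) * weight
          ≈⟨ *-congʳ (sum-replicate (suc ∣V∣)) ⟩
        (suc ∣V∣ · 1#) * weight ∎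

      other : ∀ e w → label (src e) ≢ w → term e w ≈ 0#
      other e w l≢w = ≈-trans (*-congˡ (reflexive (cong 0/1
        (trans (lookup-component F w e) (trans
          (cong (lookup F e ∧_) (dec-false (label (src e) ≟ w) l≢w))
          (Bool.∧-zeroʳ _)))))) (zeroʳ weight)

      own : ∀ e → term e (label (src e)) ≈ scaled F e
      own e = *-congˡ (reflexive (cong 0/1
        (trans (lookup-component F _ e) (trans
          (cong (lookup F e ∧_) (dec-true (label (src e) ≟ label (src e)) refl))
          (Bool.∧-identityʳ _)))))

    -- Abstracting from the list CP G keeps its decision procedures out of the goals, where
    -- normalising them would be prohibitively slow.
    module Enumeration {d} (class : Fin d → Subset ∣E∣)
      (class-isClass : ∀ i → IsCoparallelClass G (class i))
      (class-injective : ∀ {i j} → class i ≡ class j → i ≡ j)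
      (class-surjective : ∀ {C} → IsCoparallelClass G C → ∃[ i ] C ≡ class i) where

      rep : Fin d → Fin ∣E∣
      rep i = proj₁ (proj₁ (class-isClass i))

      rep∈class : ∀ i → rep i ∈ class i
      rep∈class i = proj₂ (proj₁ (class-isClass i))

      rep∉class : ∀ {i j} → i ≢ j → ¬ rep i ∈ class j
      rep∉class {i} {j} i≢j r∈ = i≢j (class-injective
        (trans (class≡cls (class-isClass i) (rep∈class i))
          (sym (class≡cls (class-isClass j) r∈))))

      ~rep : ∀ {e} → ¬ Bridge e → ∃[ i ] (e ~ rep i)
      ~rep ¬b with i , eq ← class-surjective (cls-isClass ¬b) =
        i , ∈-cls⁻ (subst (rep i ∈_) (sym eq) (rep∈class i))

      -- Affine dependence amounts to `suc d` linear equations on the coefficients: their sum and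
      -- one coordinate per class. More than `suc d` unknowns force a dependence.
      upper-bound : ∀ k (p : Vector (Vector Carrier ∣E∣) k) → (∀ j → TECSP K G (p j)) →
        AffinelyIndependent K p → k ℕ.≤ suc d
      upper-bound k p inP indep with k ℕ.≤? suc d
      ... | yes k≤ = k≤
      ... | no k≰ = Empty.⊥-elim (dependent A (ℕ.≰⇒> k≰) λ a Aa≈0 → indep a
          (≈-trans (sum-cong-≋ λ j → ≈-sym (*-identityʳ (a j))) (Aa≈0 zero))
          (coords a (Aa≈0 ∘ suc)))
        where
        A : Fin (suc d) → Vector Carrier k
        A zero    j = 1#
        A (suc i) j = p j (rep i)

        coords : ∀ a → (∀ i → sum (λ j → a j * p j (rep i)) ≈ 0#) →
          ∀ e → combination K a p e ≈ 0#
        coords a a≈0 e with bridge? e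
        ... | yes b = sum-zero λ j →
          ≈-trans (*-congˡ (tecsp-bridge {x = p j} (inP j) b)) (zeroʳ (a j))
        ... | no ¬b with i , e~r ← ~rep ¬b =
          ≈-trans (sum-cong-≋ λ j → *-congˡ (tecsp-~ {x = p j} (inP j) e~r)) (a≈0 i)

      point : Vector (Vector Carrier ∣E∣) (suc d)
      point zero    = scaled nonBridges
      point (suc i) = scaled (nonBridges ∩ ∁ (class i))

      point∈TECSP : ∀ j → TECSP K G (point j)
      point∈TECSP zero    = scaled∈TECSP nonBridges nonBridges-bridgeless
      point∈TECSP (suc i) = scaled∈TECSP _ (without-bridgeless (class-isClass i))

      -- At `rep i` every point has the value `weight`, except `point (suc i)`, which has `0#`.
      -- Comparing the combination there with `sum a * weight`, both zero, isolates `a (suc i)`;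
      -- then `sum a ≈ 0#` leaves `a zero`.
      point-independent : AffinelyIndependent K point
      point-independent a Σa≈0 comb≈0 = a≈0
        where
        rep∈N : ∀ i → lookup nonBridges (rep i) ≡ true
        rep∈N i = []=⇒lookup (∈-nonBridges⁺ (class-nonBridge (class-isClass i) (rep∈class i)))

        own : ∀ i → point (suc i) (rep i) ≈ 0#
        own i = ≈-trans (*-congˡ (reflexive (cong 0/1
          (trans (lookup-without (class i) (rep i))
            (cong₂ (λ x y → x ∧ not y) (rep∈N i) ([]=⇒lookup (rep∈class i)))))))
          (zeroʳ weight)

        other : ∀ i j → suc i ≢ j → point j (rep i) ≈ weight
        other i zero _ = ≈-trans (*-congˡ (reflexive (cong 0/1 (rep∈N i))))
          (*-identityʳ weight)
        other i (suc j) i≢j = ≈-trans (*-congˡ (reflexive (cong 0/1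
          (trans (lookup-without (class j) (rep i))
            (cong₂ (λ x y → x ∧ not y) (rep∈N i) (∉⇒lookup (rep∉class (i≢j ∘ cong suc))))))))
          (*-identityʳ weight)

        a-suc : ∀ i → a (suc i) ≈ 0#
        a-suc i = cancel (≈-trans (*-comm _ _) sum-weight) (begin
          a (suc i) * weight
            ≈⟨ sum-differ (λ j → a j * weight) (λ j → a j * point j (rep i)) (suc i)
                 (λ j i≢j → *-congˡ (≈-sym (other i j i≢j)))
                 (begin
                   sum (λ j → a j * weight)  ≈⟨ *-distribʳ-sum weight a ⟨
                   sum a * weight            ≈⟨ *-congʳ Σa≈0 ⟩
                   0# * weight               ≈⟨ zeroˡ weight ⟩
                   0#                        ≈⟨ comb≈0 (rep i) ⟨
                   combination K a point (rep i) ∎) ⟩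
          a (suc i) * point (suc i) (rep i)  ≈⟨ *-congˡ (own i) ⟩
          a (suc i) * 0#                      ≈⟨ zeroʳ _ ⟩
          0#                                  ∎)

        a-other : ∀ j → zero ≢ j → a j ≈ 0#
        a-other zero    0≢0 = contradiction refl 0≢0
        a-other (suc i) _   = a-suc i

        a≈0 : ∀ j → a j ≈ 0#
        a≈0 zero    = ≈-trans (≈-sym (sum-single a zero a-other)) Σa≈0
        a≈0 (suc i) = a-suc i

      hasDimension : HasDimension K (TECSP K G) d
      hasDimension = (point , point∈TECSP , point-independent) , upper-bound

mainTheorem1 : ∀ {c ℓ₁ ℓ₂} (K : OrderedField c ℓ₁ ℓ₂) (G : Graph) → HasDimension K (TECSP K G) (length (CP G))
mainTheorem1 K G = Polytope.Enumeration.hasDimension K G (List.lookup (CP G))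
  (λ i → Equivalence.to (∈-CP G _) (∈-lookup i))
  (lookup-injective (CP-unique G))
  (λ {C} isClass → let C∈CP = Equivalence.from (∈-CP G C) isClass in
    Any.index C∈CP , lookup-index C∈CP)
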